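{- The logic $\mathbf{GL}$ enjoys the uniform Lyndon interpolation property. Moreover, for any formula $\varphi$ and any finite sets $P,Q$ of propositional variables there exists a uniform Lyndon interpolant $\theta$ of $(\varphi,P,Q)$ in $\mathbf{GL}$ with $d(\theta)\le 3n(\varphi)+3$.
   Context: Formulas are built from countably many propositional variables, $\bot$, $\to$ and $\Box$ (other connectives are abbreviations). Modal depth: $d(p)=d(\bot)=0$, $d(\varphi\to\psi)=\max\{d(\varphi),d(\psi)\}$, $d(\Box\varphi)=d(\varphi)+1$. Positive/negative variable sets: $v^+(p)=\{p\}$, $v^-(p)=\emptyset$; $v^\pm(\bot)=\emptyset$; $v^+(\psi\to\theta)=v^-(\psi)\cup v^+(\theta)$, $v^-(\psi\to\theta)=v^+(\psi)\cup v^-(\theta)$; $v^\pm(\Box\psi)=v^\pm(\psi)$. $\mathrm{Sub}(\varphi)$ is the set of subformulas of $\varphi$ and $n(\varphi)=|\{\psi:\Box\psi\in\mathrm{Sub}(\varphi)\}|$. A normal logic is a set of formulas containing all tautologies and $\Box(p\to q)\to(\Box p\to\Box q)$, closed under modus ponens, necessitation and uniform substitution; $L\vdash\varphi$ means $\varphi\in L$. $\mathbf{GL}$ is the least normal logic containing $\Box(\Box p\to p)\to\Box p$. For a normal logic $L$, formula $\varphi$ and finite sets $P,Q$ of variables, a uniform Lyndon interpolant of $(\varphi,P,Q)$ in $L$ is a formula $\theta$ with $v^+(\theta)\subseteq v^+(\varphi)\setminus P$, $v^-(\theta)\subseteq v^-(\varphi)\setminus Q$, $L\vdash\varphi\to\theta$,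 and such that $L\vdash\theta\to\psi$ for every $\psi$ with $v^+(\psi)\cap P=v^-(\psi)\cap Q=\emptyset$ and $L\vdash\varphi\to\psi$. $L$ enjoys the uniform Lyndon interpolation property if such an interpolant exists for all $\varphi,P,Q$. -}

module Defs where

open import Data.Nat using (ℕ; zero; suc; _⊔_; _+_)
open import Data.Bool using (Bool; true; false; if_then_else_)
open import Data.List using (List; []; _∷_; _++_; length; deduplicate)
open import Data.List.Membership.Propositional using (_∈_; _∉_)
open import Data.Product using (_×_; _,_)
open import Relation.Binary.PropositionalEquality using (_≡_; refl; cong; cong₂)
open import Relation.Nullary using (Dec; yes; no; ¬_)
open import Relation.Binary.Definitions using (DecidableEquality)
import Data.Nat as ℕ

data Fm : Set where
  var  : ℕ → Fm
  ⊥'   : Fm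
  _⇒_  : Fm → Fm → Fm
  □_   : Fm → Fm

infixr 5 _⇒_
infix 7 □_

depth : Fm → ℕ
depth (var p) = 0
depth ⊥' = 0
depth (φ ⇒ ψ) = depth φ ⊔ depth ψ
depth (□ φ) = suc (depth φ)

v⁺ v⁻ : Fm → List ℕ
v⁺ (var p) = p ∷ []
v⁺ ⊥' = []
v⁺ (φ ⇒ ψ) = v⁻ φ ++ v⁺ ψ
v⁺ (□ φ) = v⁺ φ
v⁻ (var p) = []
v⁻ ⊥' = []
v⁻ (φ ⇒ ψ) = v⁺ φ ++ v⁻ ψ
v⁻ (□ φ) = v⁻ φ

_≟F_ : DecidableEquality Fm
var p ≟F var q with p ℕ.≟ q
... | yes refl = yes refl
... | no ne = no λ { refl → ne refl }
var _ ≟F ⊥' = no λ ()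
var _ ≟F (_ ⇒ _) = no λ ()
var _ ≟F (□ _) = no λ ()
⊥' ≟F var _ = no λ ()
⊥' ≟F ⊥' = yes refl
⊥' ≟F (_ ⇒ _) = no λ ()
⊥' ≟F (□ _) = no λ ()
(_ ⇒ _) ≟F var _ = no λ ()
(_ ⇒ _) ≟F ⊥' = no λ ()
(a ⇒ b) ≟F (c ⇒ d) with a ≟F c | b ≟F d
... | yes refl | yes refl = yes refl
... | no ne | _ = no λ { refl → ne refl }
... | yes _ | no ne = no λ { refl → ne refl }
(_ ⇒ _) ≟F (□ _) = no λ ()
(□ _) ≟F var _ = no λ ()
(□ _) ≟F ⊥' = no λ ()
(□ _) ≟F (_ ⇒ _) = no λ ()
(□ a) ≟F (□ b) with a ≟F b
... | yes refl = yes refl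
... | no ne = no λ { refl → ne refl }

Sub : Fm → List Fm
Sub (var p) = var p ∷ []
Sub ⊥' = ⊥' ∷ []
Sub (φ ⇒ ψ) = (φ ⇒ ψ) ∷ (Sub φ ++ Sub ψ)
Sub (□ φ) = □ φ ∷ Sub φ

boxBodies : Fm → List Fm
boxBodies (var p) = []
boxBodies ⊥' = []
boxBodies (φ ⇒ ψ) = boxBodies φ ++ boxBodies ψ
boxBodies (□ φ) = φ ∷ boxBodies φ

nBox : Fm → ℕ
nBox φ = length (deduplicate _≟F_ (boxBodies φ))

-- Classical tautologies: true under every Boolean valuation of the
-- "propositional atoms" of the modal language (variables and □-formulas).
eval : (Fm → Bool) → Fm → Bool
eval V (var p) = V (var p)
eval V ⊥' = false
eval V (φ ⇒ ψ) = if eval V φ then eval V ψ else true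
eval V (□ φ) = V (□ φ)

Tautology : Fm → Set
Tautology φ = ∀ (V : Fm → Bool) → eval V φ ≡ true

subst : (ℕ → Fm) → Fm → Fm
subst σ (var p) = σ p
subst σ ⊥' = ⊥'
subst σ (φ ⇒ ψ) = subst σ φ ⇒ subst σ ψ
subst σ (□ φ) = □ subst σ φ

p₀ q₀ : Fm
p₀ = var 0
q₀ = var 1

data GL⊢_ : Fm → Set where
  taut : ∀ {φ} → Tautology φ → GL⊢ φ
  axK  : GL⊢ (□ (p₀ ⇒ q₀) ⇒ (□ p₀ ⇒ □ q₀))
  axL  : GL⊢ (□ (□ p₀ ⇒ p₀) ⇒ □ p₀)
  mp   : ∀ {φ ψ} → GL⊢ (φ ⇒ ψ) → GL⊢ φ → GL⊢ ψ
  nec  : ∀ {φ} → GL⊢ φ → GL⊢ (□ φ)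
  usub : ∀ {φ} (σ : ℕ → Fm) → GL⊢ φ → GL⊢ (subst σ φ)

IsULI : (Fm → Set) → Fm → List ℕ → List ℕ → Fm → Set
IsULI L φ P Q θ =
  (∀ x → x ∈ v⁺ θ → (x ∈ v⁺ φ × x ∉ P)) ×
  (∀ x → x ∈ v⁻ θ → (x ∈ v⁻ φ × x ∉ Q)) ×
  L (φ ⇒ θ) ×
  (∀ ψ → (∀ x → x ∈ v⁺ ψ → x ∉ P) → (∀ x → x ∈ v⁻ ψ → x ∉ Q) →
     L (φ ⇒ ψ) → L (θ ⇒ ψ))

{-# OPTIONS --safe #-}

-- A type V is a valuation of the atoms of φ (its variables and its boxed subformulas). By
-- recursion on k a formula simulates k V is written down which says of a world x of a finite
-- transitive converse well-founded model M that the pairs (x , V), with x ⊩ simulates k V, form a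
-- model in which (x , V) satisfies what V says about φ, while projecting to x without disturbing
-- formulas that avoid P positively and Q negatively. Along successors the set of boxes true in V
-- can only grow; where it does not grow the same demands are repeated, and transitivity lets a
-- single box speak about the whole cluster, so no fixed point is needed and k only has to exceed the
-- number of boxes. The interpolant is the disjunction of simulates (n(φ) + 1) V over the types V
-- of φ; each step costs two boxes, whence depth at most 2n(φ) + 2.
module Submission where

open import Defs
open import Data.Bool using (Bool; true; false; if_then_else_)
import Data.Bool.Properties as Bool
open import Data.Bool.Properties using (¬-not)
open import Data.Empty using (⊥)
open import Data.List using (List; []; _∷_; _++_; length; filter; map; foldr; deduplicate; upTo; cartesianProduct)
open import Data.List.Properties using (length-filter)
open import Data.List.Membership.Propositional using (_∈_; _∉_; find; lose)
open import Data.List.Membership.Propositional.Properties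
  using (∈-++⁺ˡ; ∈-++⁺ʳ; ∈-++⁻; ∈-map⁺; ∈-map⁻; ∈-filter⁺; ∈-filter⁻; ∈-deduplicate⁺; ∈-deduplicate⁻;
         ∈-cartesianProduct⁺; ∈-cartesianProduct⁻; ∈-upTo⁺; ∈-upTo⁻)
open import Data.List.Relation.Binary.Subset.Propositional using (_⊆_)
open import Data.List.Relation.Unary.All as All using (All; all?)
open import Data.List.Relation.Unary.All.Properties using (¬All⇒Any¬)
open import Data.List.Relation.Unary.Any using (Any; here; there; any?)
import Data.List.Membership.DecPropositional as DecMembership
open import Data.Nat as ℕ using (ℕ; zero; suc; _≤_; _<_; _*_; _+_; z≤n; s≤s; s≤s⁻¹)
open import Data.Nat.Induction using (<-wellFounded)
open import Data.Nat.Properties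
  using (≤-refl; ≤-trans; <-trans; <-≤-trans; n≤1+n; m≤n⇒m≤1+n; ⊔-lub; *-monoʳ-≤; *-comm; *-suc; +-comm;
         module ≤-Reasoning)
open import Data.Product using (Σ; ∃-syntax; _×_; _,_; proj₁; proj₂)
open import Data.Sum using (_⊎_; inj₁; inj₂; [_,_]′)
open import Function using (_∘_; id)
open import Induction.WellFounded using (Acc; acc; WellFounded; module Subrelation)
import Relation.Binary.Construct.On as On
open import Relation.Binary.PropositionalEquality using (_≡_; refl; sym; trans; cong)
open import Relation.Nullary using (Dec; yes; no; ¬_; does; contradiction)
open import Relation.Nullary.Decidable
  using (¬?; _×-dec_; _⊎-dec_; _→-dec_; dec-true; dec-false; map′; decidable-stable)

private
  variable
    I : Set
    A B C : Fm
    f g : Fm → Bool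

-- Defined connectives and classical truth assignments.

infixr 6 _∧′_
infixr 5 _∨′_
infix 6 _⇛_
infix 7 ~_ ◇_
infix 4 _⊩_ _⊩?_

~_ : Fm → Fm
~ A = A ⇒ ⊥'

_∧′_ _∨′_ : Fm → Fm → Fm
A ∧′ B = ~ (A ⇒ ~ B)
A ∨′ B = ~ A ⇒ B

◇_ : Fm → Fm
◇ A = ~ (□ (~ A))

⋀ ⋁ : (I → Fm) → List I → Fm
⋀ G = foldr (λ i A → G i ∧′ A) (~ ⊥')
⋁ G = foldr (λ i A → G i ∨′ A) ⊥'

-- A record rather than a synonym, so that A can be inferred from f ⊩ A.
record _⊩_ (f : Fm → Bool) (A : Fm) : Set where
  constructor holds
  field
    isTrue : f A ≡ true

open _⊩_

_⊩?_ : ∀ f A → Dec (f ⊩ A)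
f ⊩? A = map′ holds isTrue (f A Bool.≟ true)

⊩-≡ : (f ⊩ A → g ⊩ B) → (g ⊩ B → f ⊩ A) → f A ≡ g B
⊩-≡ {f} {A} {g} {B} to from with g ⊩? B
... | yes b = trans (isTrue (from b)) (sym (isTrue b))
... | no ¬b = trans (¬-not (¬b ∘ to ∘ holds)) (sym (¬-not (¬b ∘ holds)))

-- Shared by Boolean valuations `eval V` and by forcing at a world, so that propositional reasoning
-- is developed once for both.
record Classical (f : Fm → Bool) : Set where
  field
    bot : f ⊥' ≡ false
    imp : ∀ A B → f (A ⇒ B) ≡ (if f A then f B else true)

  ⊥-absurd : ¬ f ⊩ ⊥'
  ⊥-absurd (holds p) with () ← trans (sym bot) p

  ⇒-intro : (f ⊩ A → f ⊩ B) → f ⊩ (A ⇒ B)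
  ⇒-intro {A} {B} h = holds (trans (imp A B) (go (f A) λ a → isTrue (h (holds a))))
    where
    go : ∀ b → (b ≡ true → f B ≡ true) → (if b then f B else true) ≡ true
    go true  h = h refl
    go false h = refl

  ⇒-elim : f ⊩ (A ⇒ B) → f ⊩ A → f ⊩ B
  ⇒-elim {A} {B} (holds h) (holds a) =
    holds (trans (cong (λ b → if b then f B else true) (sym a)) (trans (sym (imp A B)) h))

  ~-intro : ¬ f ⊩ A → f ⊩ ~ A
  ~-intro ¬a = ⇒-intro λ a → contradiction a ¬a

  ~-elim : f ⊩ ~ A → ¬ f ⊩ A
  ~-elim h a = ⊥-absurd (⇒-elim h a)

  ∧-intro : f ⊩ A → f ⊩ B → f ⊩ (A ∧′ B)
  ∧-intro a b = ~-intro λ h → ~-elim (⇒-elim h a) b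

  ∧-elim : f ⊩ (A ∧′ B) → f ⊩ A × f ⊩ B
  ∧-elim {A} {B} h =
      decidable-stable (f ⊩? A) (λ ¬a → ~-elim h (⇒-intro λ a → contradiction a ¬a))
    , decidable-stable (f ⊩? B) (λ ¬b → ~-elim h (⇒-intro λ _ → ~-intro ¬b))

  ∨-introˡ : f ⊩ A → f ⊩ (A ∨′ B)
  ∨-introˡ a = ⇒-intro λ ¬a → contradiction a (~-elim ¬a)

  ∨-introʳ : f ⊩ B → f ⊩ (A ∨′ B)
  ∨-introʳ b = ⇒-intro λ _ → b

  ∨-elim : f ⊩ (A ∨′ B) → f ⊩ A ⊎ f ⊩ B
  ∨-elim {A} h with f ⊩? A
  ... | yes a = inj₁ a
  ... | no ¬a = inj₂ (⇒-elim h (~-intro ¬a))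

  ⋀-intro : ∀ {G : I → Fm} xs → (∀ {i} → i ∈ xs → f ⊩ G i) → f ⊩ ⋀ G xs
  ⋀-intro []       h = ~-intro ⊥-absurd
  ⋀-intro (x ∷ xs) h = ∧-intro (h (here refl)) (⋀-intro xs (h ∘ there))

  ⋀-elim : ∀ {G : I → Fm} {xs i} → f ⊩ ⋀ G xs → i ∈ xs → f ⊩ G i
  ⋀-elim h (here refl) = proj₁ (∧-elim h)
  ⋀-elim h (there i∈)  = ⋀-elim (proj₂ (∧-elim h)) i∈

  ⋁-intro : ∀ {G : I → Fm} {xs i} → i ∈ xs → f ⊩ G i → f ⊩ ⋁ G xs
  ⋁-intro (here refl) a = ∨-introˡ a
  ⋁-intro (there i∈)  a = ∨-introʳ (⋁-intro i∈ a)

  ⋁-elim : ∀ {G : I → Fm} xs → f ⊩ ⋁ G xs → ∃[ i ] i ∈ xs × f ⊩ G i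
  ⋁-elim []       h = contradiction h ⊥-absurd
  ⋁-elim (x ∷ xs) h with ∨-elim h
  ... | inj₁ a = x , here refl , a
  ... | inj₂ t with ⋁-elim xs t
  ...   | i , i∈ , a = i , there i∈ , a

eval-classical : ∀ V → Classical (eval V)
eval-classical V = record { bot = refl ; imp = λ _ _ → refl }

module Eval (V : Fm → Bool) = Classical (eval-classical V)

-- Collection continues below a box, so that a valuation of `atoms φ` decides the body of every
-- boxed subformula and not only `φ` itself.
atoms : Fm → List Fm
atoms (var p) = var p ∷ []
atoms ⊥'      = []
atoms (A ⇒ B) = atoms A ++ atoms B
atoms (□ A)   = □ A ∷ atoms A

eval-cong : Classical f → ∀ A {V} → (∀ {a} → a ∈ atoms A → V a ≡ f a) → eval V A ≡ f A
eval-cong cl (var p) h = h (here refl)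
eval-cong cl ⊥'      h = sym (Classical.bot cl)
eval-cong cl (A ⇒ B) h
  rewrite eval-cong cl A (h ∘ ∈-++⁺ˡ) | eval-cong cl B (h ∘ ∈-++⁺ʳ (atoms A)) = sym (Classical.imp cl A B)
eval-cong cl (□ A)   h = h (here refl)

eval-self : Classical f → ∀ A → eval f A ≡ f A
eval-self cl A = eval-cong cl A λ _ → refl

∈-map-elim : ∀ (P : Fm → Set) {G : I → Fm} {xs} → (∀ {i} → i ∈ xs → P (G i)) → ∀ {C} → C ∈ map G xs → P C
∈-map-elim P {G} h i with _ , i∈ , refl ← ∈-map⁻ G i = h i∈

-- Derivability in GL

-- The premises are discharged one by one by modus ponens from a single tautology. Propositional
-- derivations thereby become semantic arguments about an arbitrary valuation.
tautological-consequence : ∀ Γ → (∀ {C} → C ∈ Γ → GL⊢ C) →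
  (∀ V → (∀ {C} → C ∈ Γ → eval V ⊩ C) → eval V ⊩ A) → GL⊢ A
tautological-consequence []      ⊢Γ h = taut λ V → isTrue (h V λ ())
tautological-consequence (C ∷ Γ) ⊢Γ h = mp
  (tautological-consequence Γ (⊢Γ ∘ there) λ V v →
    Eval.⇒-intro V λ c → h V λ { (here refl) → c ; (there i) → v i })
  (⊢Γ (here refl))

tautology : (∀ V → eval V ⊩ A) → GL⊢ A
tautology h = taut λ V → isTrue (h V)

consequence₁ : (∀ V → eval V ⊩ A → eval V ⊩ B) → GL⊢ A → GL⊢ B
consequence₁ h a = mp (tautology λ V → Eval.⇒-intro V (h V)) a

⇒-trans : GL⊢ (A ⇒ B) → GL⊢ (B ⇒ C) → GL⊢ (A ⇒ C)
⇒-trans ab bc = mp (mp (tautology λ V → let open Eval V in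
  ⇒-intro λ ab → ⇒-intro λ bc → ⇒-intro λ a → ⇒-elim bc (⇒-elim ab a)) ab) bc

□-K : ∀ A B → GL⊢ (□ (A ⇒ B) ⇒ □ A ⇒ □ B)
□-K A B = usub (λ { zero → A ; (suc _) → B }) axK

□-Löb : ∀ A → GL⊢ (□ (□ A ⇒ A) ⇒ □ A)
□-Löb A = usub (λ _ → A) axL

□-mono : GL⊢ (A ⇒ B) → GL⊢ (□ A ⇒ □ B)
□-mono h = mp (□-K _ _) (nec h)

-- Löb's axiom for B ∧ □ B.
□-4 : ∀ B → GL⊢ (□ B ⇒ □ □ B)
□-4 B = ⇒-trans (⇒-trans (□-mono step) (□-Löb (B ∧′ □ B))) (□-mono right)
  where
  left : GL⊢ (B ∧′ □ B ⇒ B)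
  left = tautology λ V → let open Eval V in ⇒-intro (proj₁ ∘ ∧-elim)
  right : GL⊢ (B ∧′ □ B ⇒ □ B)
  right = tautology λ V → let open Eval V in ⇒-intro (proj₂ ∘ ∧-elim)
  step : GL⊢ (B ⇒ □ (B ∧′ □ B) ⇒ B ∧′ □ B)
  step = consequence₁ (λ V h → let open Eval V in
    ⇒-intro λ b → ⇒-intro λ d → ∧-intro b (⇒-elim h d)) (□-mono left)

_⇛_ : List Fm → Fm → Fm
Γ ⇛ A = foldr _⇒_ A Γ

⇛-intro : ∀ V Γ → ((∀ {C} → C ∈ Γ → eval V ⊩ C) → eval V ⊩ A) → eval V ⊩ (Γ ⇛ A)
⇛-intro V []      h = h λ ()
⇛-intro V (C ∷ Γ) h = Eval.⇒-intro V λ c → ⇛-intro V Γ λ v →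
  h λ { (here refl) → c ; (there i) → v i }

⇛-elim : ∀ V Γ → eval V ⊩ (Γ ⇛ A) → (∀ {C} → C ∈ Γ → eval V ⊩ C) → eval V ⊩ A
⇛-elim V []      h v = h
⇛-elim V (C ∷ Γ) h v = ⇛-elim V Γ (Eval.⇒-elim V h (v (here refl))) (v ∘ there)

□-distrib-⇛ : ∀ Γ A → GL⊢ (□ (Γ ⇛ A) ⇒ (map □_ Γ ⇛ □ A))
□-distrib-⇛ []      A = tautology λ V → Eval.⇒-intro V id
□-distrib-⇛ (C ∷ Γ) A = mp (mp (tautology λ V → let open Eval V in
  ⇒-intro λ k → ⇒-intro λ ih → ⇒-intro λ h → ⇒-intro λ c → ⇒-elim ih (⇒-elim (⇒-elim k h) c))
  (□-K C (Γ ⇛ A))) (□-distrib-⇛ Γ A)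

-- Kripke semantics

-- Finite successor lists make forcing of a box decidable, so `force` can take values in `Bool`.
record Model : Set₁ where
  field
    World        : Set
    succs        : World → List World
    succs-trans  : ∀ {x y z} → y ∈ succs x → z ∈ succs y → z ∈ succs x
    succs-wf     : WellFounded (λ y x → y ∈ succs x)
    val          : World → ℕ → Bool

  force : World → Fm → Bool
  force x (var p) = val x p
  force x ⊥'      = false
  force x (A ⇒ B) = if force x A then force x B else true
  force x (□ A)   = does (all? (λ y → force y A Bool.≟ true) (succs x))

  force-classical : ∀ x → Classical (force x)
  force-classical x = record { bot = refl ; imp = λ _ _ → refl }

  module Force {x : World} = Classical (force-classical x)

  □-intro : ∀ {x} → (∀ {y} → y ∈ succs x → force y ⊩ A) → force x ⊩ □ A
  □-intro {A} {x} h =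
    holds (dec-true (all? (λ y → force y A Bool.≟ true) (succs x)) (All.tabulate (isTrue ∘ h)))

  □-elim : ∀ {x y} → force x ⊩ □ A → y ∈ succs x → force y ⊩ A
  □-elim {A} {x} (holds h) y∈ with all? (λ y → force y A Bool.≟ true) (succs x)
  ... | yes all = holds (All.lookup all y∈)

  ¬□-elim : ∀ {x} → ¬ force x ⊩ □ A → ∃[ y ] y ∈ succs x × ¬ force y ⊩ A
  ¬□-elim {A} {x} h =
    find (¬All⇒Any¬ (λ y → force y ⊩? A) (succs x) λ all → h (□-intro (All.lookup all)))

  ◇-intro : ∀ {x y} → y ∈ succs x → force y ⊩ A → force x ⊩ ◇ A
  ◇-intro y∈ a = Force.~-intro λ h → Force.~-elim (□-elim h y∈) a

  ◇-elim : ∀ {x} → force x ⊩ ◇ A → ∃[ y ] y ∈ succs x × force y ⊩ A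
  ◇-elim {A} h with ¬□-elim (Force.~-elim h)
  ... | y , y∈ , ¬¬a = y , y∈ , decidable-stable (force y ⊩? A) (¬¬a ∘ Force.~-intro)

  □-trans : ∀ {x y} → force x ⊩ □ A → y ∈ succs x → force y ⊩ □ A
  □-trans h y∈ = □-intro λ z∈ → □-elim h (succs-trans y∈ z∈)

  -- The semantic content of Löb's axiom. As long as the refuting successor found still fails `□ A`,
  -- the search moves on to one of its successors; converse well-foundedness stops it, and
  -- transitivity makes the result a successor of `x`.
  ¬□-last : ∀ {x} → ¬ force x ⊩ □ A → ∃[ y ] y ∈ succs x × ¬ force y ⊩ A × force y ⊩ □ A
  ¬□-last {A} {x} = go (succs-wf x)
    where
    go : ∀ {x} → Acc (λ y x → y ∈ succs x) x → ¬ force x ⊩ □ A →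
         ∃[ y ] y ∈ succs x × ¬ force y ⊩ A × force y ⊩ □ A
    go (acc rs) h with ¬□-elim h
    ... | y , y∈ , ¬a with force y ⊩? □ A
    ...   | yes □a = y , y∈ , ¬a , □a
    ...   | no ¬□a with go (rs y∈) ¬□a
    ...     | z , z∈ , rest = z , succs-trans y∈ z∈ , rest

open Model using (force)

-- Substitution in models and soundness.

module _ (M : Model) (σ : ℕ → Fm) where
  private module M = Model M

  substModel : Model
  substModel = record
    { World = M.World ; succs = M.succs ; succs-trans = M.succs-trans ; succs-wf = M.succs-wf
    ; val = λ x p → M.force x (σ p) }

  force-subst : ∀ A x → force substModel x A ≡ M.force x (subst σ A)
  force-subst (var p) x = refl
  force-subst ⊥'      x = refl
  force-subst (A ⇒ B) x rewrite force-subst A x | force-subst B x = refl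
  force-subst (□ A)   x = ⊩-≡ {force substModel x} {□ A} {M.force x} {□ subst σ A}
    (λ h → M.□-intro λ {y} y∈ → holds (trans (sym (force-subst A y)) (isTrue (Model.□-elim substModel h y∈))))
    (λ h → Model.□-intro substModel λ {y} y∈ → holds (trans (force-subst A y) (isTrue (M.□-elim h y∈))))

-- A tautology is evaluated at the valuation `force M x` itself, Löb's axiom is `¬□-last`, and a
-- substitution is absorbed by passing to `substModel`; this last case is why the models must be
-- quantified inside the induction.
soundness : GL⊢ A → ∀ M x → force M x ⊩ A
soundness (taut {A} t) M x = holds (trans (sym (eval-self (Model.force-classical M x) A)) (t (force M x)))
soundness axK M x = ⇒-intro λ h → ⇒-intro λ a → □-intro λ y∈ → ⇒-elim (□-elim h y∈) (□-elim a y∈)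
  where open Model M; open Force
soundness axL M x = ⇒-intro λ h → decidable-stable (force M x ⊩? □ p₀) λ ¬□p →
    let y , y∈ , ¬p , □p = ¬□-last ¬□p in ¬p (⇒-elim (□-elim h y∈) □p)
  where open Model M hiding (force); open Force
soundness (mp h a) M x = Model.Force.⇒-elim M (soundness h M x) (soundness a M x)
soundness (nec h) M x = Model.□-intro M λ {y} _ → soundness h M y
soundness (usub {A} σ h) M x =
  holds (trans (sym (force-subst M σ A x)) (isTrue (soundness h (substModel M σ) x)))

-- Valuations of the atoms of a formula

update : (Fm → Bool) → Fm → Bool → Fm → Bool
update V a b c = if does (c ≟F a) then b else V c

valuations : List Fm → List (Fm → Bool)
valuations []       = (λ _ → false) ∷ []
valuations (a ∷ as) = map (λ (V , b) → update V a b) (cartesianProduct (valuations as) (true ∷ false ∷ []))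

-- Agreement is asked for on `as` only. By `eval-cong` this fixes the value of every formula whose
-- atoms lie in `as`, and it spares any appeal to function extensionality.
valuations-complete : ∀ (f : Fm → Bool) as → ∃[ V ] V ∈ valuations as × (∀ {a} → a ∈ as → V a ≡ f a)
valuations-complete f []       = _ , here refl , λ ()
valuations-complete f (a ∷ as) with valuations-complete f as
... | V , V∈ , V≈f = update V a (f a) , ∈-map⁺ _ (∈-cartesianProduct⁺ V∈ (bool∈ (f a))) , agree
  where
  bool∈ : ∀ b → b ∈ true ∷ false ∷ []
  bool∈ true  = here refl
  bool∈ false = there (here refl)
  agree : ∀ {c} → c ∈ a ∷ as → update V a (f a) c ≡ f c
  agree {c} c∈ with c ≟F a
  agree c∈         | yes refl = refl
  agree (here c≡a) | no c≢a = contradiction c≡a c≢a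
  agree (there c∈) | no c≢a = V≈f c∈

□∈atoms⇒∈boxBodies : ∀ C → □ A ∈ atoms C → A ∈ boxBodies C
□∈atoms⇒∈boxBodies (var p) (here ())
□∈atoms⇒∈boxBodies (C ⇒ D) i with ∈-++⁻ (atoms C) i
... | inj₁ j = ∈-++⁺ˡ (□∈atoms⇒∈boxBodies C j)
... | inj₂ j = ∈-++⁺ʳ (boxBodies C) (□∈atoms⇒∈boxBodies D j)
□∈atoms⇒∈boxBodies (□ C) (here refl) = here refl
□∈atoms⇒∈boxBodies (□ C) (there i)   = there (□∈atoms⇒∈boxBodies C i)

∈boxBodies⇒atoms-⊆ : ∀ C → A ∈ boxBodies C → atoms (□ A) ⊆ atoms C
∈boxBodies⇒atoms-⊆ (C ⇒ D) i with ∈-++⁻ (boxBodies C) i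
... | inj₁ j = ∈-++⁺ˡ ∘ ∈boxBodies⇒atoms-⊆ C j
... | inj₂ j = ∈-++⁺ʳ (atoms C) ∘ ∈boxBodies⇒atoms-⊆ D j
∈boxBodies⇒atoms-⊆ (□ C) (here refl) = id
∈boxBodies⇒atoms-⊆ (□ C) (there i)   = there ∘ ∈boxBodies⇒atoms-⊆ C i

module _ {P Q : I → Set} (P? : ∀ i → Dec (P i)) (Q? : ∀ i → Dec (Q i)) where

  length-filter-≤ : ∀ xs → (∀ {i} → i ∈ xs → P i → Q i) → length (filter P? xs) ≤ length (filter Q? xs)
  length-filter-≤ []       P⇒Q = z≤n
  length-filter-≤ (x ∷ xs) P⇒Q with P? x | Q? x | length-filter-≤ xs (P⇒Q ∘ there)
  ... | yes p | yes q | ih = s≤s ih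
  ... | yes p | no ¬q | ih = contradiction (P⇒Q (here refl) p) ¬q
  ... | no _  | yes q | ih = m≤n⇒m≤1+n ih
  ... | no _  | no _  | ih = ih

  length-filter-< : ∀ {i} xs → (∀ {i} → i ∈ xs → P i → Q i) → i ∈ xs → ¬ P i → Q i →
                    length (filter P? xs) < length (filter Q? xs)
  length-filter-< (x ∷ xs) P⇒Q (here refl) ¬p q with P? x | Q? x
  ... | yes p | _     = contradiction p ¬p
  ... | no _  | yes _ = s≤s (length-filter-≤ xs (P⇒Q ∘ there))
  ... | no _  | no ¬q = contradiction q ¬q
  length-filter-< (x ∷ xs) P⇒Q (there i∈) ¬p q with P? x | Q? x | length-filter-< xs (P⇒Q ∘ there) i∈ ¬p q
  ... | yes p | yes q | ih = s≤s ih
  ... | yes p | no ¬q | ih = contradiction (P⇒Q (here refl) p) ¬q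
  ... | no _  | yes q | ih = m≤n⇒m≤1+n ih
  ... | no _  | no _  | ih = ih

-- Types of a formula, their ordering and their height.

module Closure (φ : Fm) where

  -- Deduplicated so that `length bodies` is `nBox φ` by definition.
  bodies : List Fm
  bodies = deduplicate _≟F_ (boxBodies φ)

  types : List (Fm → Bool)
  types = valuations (atoms φ)

  body : atoms (□ A) ⊆ atoms φ → A ∈ bodies
  body sub = ∈-deduplicate⁺ _≟F_ (□∈atoms⇒∈boxBodies φ (sub (here refl)))

  body-⊆ : A ∈ bodies → atoms (□ A) ⊆ atoms φ
  body-⊆ A∈ = ∈boxBodies⇒atoms-⊆ φ (∈-deduplicate⁻ _≟F_ (boxBodies φ) A∈)

  _≈_ : (Fm → Bool) → (Fm → Bool) → Set
  V ≈ f = ∀ {a} → a ∈ atoms φ → V a ≡ f a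

  module _ {f V} (cl : Classical f) (V≈f : V ≈ f) where

    ≈-to : atoms A ⊆ atoms φ → f ⊩ A → eval V ⊩ A
    ≈-to {A} sub (holds h) = holds (trans (eval-cong cl A (V≈f ∘ sub)) h)

    ≈-from : atoms A ⊆ atoms φ → eval V ⊩ A → f ⊩ A
    ≈-from {A} sub (holds h) = holds (trans (sym (eval-cong cl A (V≈f ∘ sub))) h)

  type-of : ∀ f → ∃[ V ] V ∈ types × V ≈ f
  type-of f = valuations-complete f (atoms φ)

  -- The accessibility relation of the canonical model.
  _≼_ : (Fm → Bool) → (Fm → Bool) → Set
  f ≼ g = All (λ B → f ⊩ □ B → g ⊩ □ B × g ⊩ B) bodies

  _≼?_ : ∀ f g → Dec (f ≼ g)
  f ≼? g = all? (λ B → (f ⊩? □ B) →-dec ((g ⊩? □ B) ×-dec (g ⊩? B))) bodies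

  ≼-trans : ∀ {f g h} → f ≼ g → g ≼ h → f ≼ h
  ≼-trans fg gh = All.tabulate λ B∈ □B → All.lookup gh B∈ (proj₁ (All.lookup fg B∈ □B))

  ≈-≼ : ∀ {f g V W} → Classical f → Classical g → V ≈ f → W ≈ g → f ≼ g → eval V ≼ eval W
  ≈-≼ clf clg V≈f W≈g f≼g = All.tabulate λ B∈ □B →
    let □b , b = All.lookup f≼g B∈ (≈-from clf V≈f (body-⊆ B∈) □B)
    in ≈-to clg W≈g (body-⊆ B∈) □b , ≈-to clg W≈g (body-⊆ B∈ ∘ there) b

  -- The measure behind both inductions on `k`: it is at most `n(φ)`, never grows along `≼`, and
  -- drops as soon as a new box becomes true.
  height : (Fm → Bool) → ℕ
  height f = length (filter (λ B → ¬? (f ⊩? □ B)) bodies)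

  height-< : f ≼ g → A ∈ bodies → ¬ f ⊩ □ A → g ⊩ □ A → height g < height f
  height-< {f} {g} f≼g A∈ ¬□a □a =
    length-filter-< (λ B → ¬? (g ⊩? □ B)) (λ B → ¬? (f ⊩? □ B)) bodies
      (λ B∈ ¬g f□ → ¬g (proj₁ (All.lookup f≼g B∈ f□))) A∈ (λ ¬g → ¬g □a) ¬□a

  height-≤ : height f ≤ length bodies
  height-≤ {f} = length-filter (λ B → ¬? (f ⊩? □ B)) bodies

  module _ (M : Model) where
    open Model M hiding (force)

    force-≼ : ∀ {x y} → y ∈ succs x → force M x ≼ force M y
    force-≼ y∈ = All.tabulate λ _ □b → □-trans □b y∈ , □-elim □b y∈

-- Completeness

module Completeness (φ : Fm) where
  open Closure φ

  -- Realisability of a type in a tree of height less than k.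
  mutual
    Real : ℕ → (Fm → Bool) → Set
    Real zero    V = ⊥
    Real (suc k) V = All (λ A → eval V ⊩ □ A ⊎ Any (Refutes k V A) types) bodies

    -- The demand for `□ A` at `W`, in the manner of `¬□-last`, makes the height of `W` smaller than
    -- that of a type where `□ A` fails.
    Refutes : ℕ → (Fm → Bool) → Fm → (Fm → Bool) → Set
    Refutes k V A W = (eval V ≼ eval W × eval W ⊩ □ A × ¬ eval W ⊩ A) × Real k W

  mutual
    real? : ∀ k V → Dec (Real k V)
    real? zero    V = no λ ()
    real? (suc k) V = all? (λ A → (eval V ⊩? □ A) ⊎-dec any? (refutes? k V A) types) bodies

    refutes? : ∀ k V A W → Dec (Refutes k V A W)
    refutes? k V A W =
      ((eval V ≼? eval W) ×-dec (eval W ⊩? □ A) ×-dec ¬? (eval W ⊩? A)) ×-dec real? k W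

  literal : (Fm → Bool) → Fm → Fm
  literal V a = if V a then a else ~ a

  diagram : (Fm → Bool) → Fm
  diagram V = ⋀ (literal V) (atoms φ)

  diagram-intro : ∀ {V} → Classical f → V ≈ f → f ⊩ diagram V
  diagram-intro {f} {V} cl V≈f = ⋀-intro (atoms φ) λ {a} a∈ → go (V a) (V≈f a∈)
    where
    open Classical cl
    go : ∀ {a} b → b ≡ f a → f ⊩ (if b then a else ~ a)
    go true  e = holds (sym e)
    go false e = ~-intro λ (holds h) → contradiction (trans e h) λ ()

  diagram-elim : ∀ {V} → Classical f → f ⊩ diagram V → V ≈ f
  diagram-elim {f} {V} cl h {a} a∈ = go (V a) (⋀-elim h a∈)
    where
    open Classical cl
    go : ∀ {a} b → f ⊩ (if b then a else ~ a) → b ≡ f a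
    go true  h = sym (isTrue h)
    go false h = sym (¬-not (~-elim h ∘ holds))

  -- Some `□ A` false in `V` has no realisable refuting type. Every candidate for one has smaller
  -- height, so its diagram is refutable by induction, and hence `Γ`, the boxes of `V` together with
  -- their bodies, proves `□ A ⇒ A`. Necessitation and Löb's axiom turn this into a derivation of
  -- `□ A` from the boxed members of `Γ`, which `diagram V` provides with the help of `□ B ⇒ □ □ B`.
  -- But `V` makes `□ A` false.
  unreal-refutable : ∀ k V → height (eval V) < k → ¬ Real k V → GL⊢ (~ (diagram V))
  unreal-refutable (suc k) V (s≤s hV≤k) ¬real
    with A , A∈ , ¬A ← find (¬All⇒Any¬ (λ A → (eval V ⊩? □ A) ⊎-dec any? (refutes? k V A) types) bodies ¬real)
    = tautological-consequence
        ((map □_ Γ ⇛ □ (□ A ⇒ A)) ∷ (□ (□ A ⇒ A) ⇒ □ A) ∷ map (λ B → □ B ⇒ □ □ B) boxed)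
        (λ { (here refl) → mp (□-distrib-⇛ Γ (□ A ⇒ A)) (nec Γ⊢Löb)
           ; (there (here refl)) → □-Löb A
           ; (there (there i)) → ∈-map-elim GL⊢_ (λ {B} _ → □-4 B) i })
        final
    where
    boxed Γ : List Fm
    boxed = filter (λ B → eval V ⊩? □ B) bodies
    Γ = boxed ++ map □_ boxed

    candidate? : ∀ W → Dec (eval V ≼ eval W × eval W ⊩ □ A × ¬ eval W ⊩ A)
    candidate? W = (eval V ≼? eval W) ×-dec (eval W ⊩? □ A) ×-dec ¬? (eval W ⊩? A)

    candidate-refutable : ∀ {W} → W ∈ filter candidate? types → GL⊢ (~ (diagram W))
    candidate-refutable {W} W∈ =
      let W∈types , cand@(V≼W , □a , _) = ∈-filter⁻ candidate? W∈
      in unreal-refutable k W (<-≤-trans (height-< V≼W A∈ (¬A ∘ inj₁) □a) hV≤k)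
           λ real → ¬A (inj₂ (lose W∈types (cand , real)))

    Γ⊢Löb : GL⊢ (Γ ⇛ (□ A ⇒ A))
    Γ⊢Löb = tautological-consequence (map (λ W → ~ (diagram W)) (filter candidate? types))
      (∈-map-elim GL⊢_ candidate-refutable)
      λ U hyp → let open Eval U in ⇛-intro U Γ λ γ → ⇒-intro λ □a → decidable-stable (eval U ⊩? A) λ ¬a →
        let W , W∈ , W≈U = type-of (eval U)
            cl = eval-classical U
            V≼W = All.tabulate λ B∈ □B →
              let B∈boxed = ∈-filter⁺ (λ B → eval V ⊩? □ B) B∈ □B
              in ≈-to cl W≈U (body-⊆ B∈) (γ (∈-++⁺ʳ boxed (∈-map⁺ □_ B∈boxed)))
               , ≈-to cl W≈U (body-⊆ B∈ ∘ there) (γ (∈-++⁺ˡ B∈boxed))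
            W∈candidates = ∈-filter⁺ candidate? W∈
              (V≼W , ≈-to cl W≈U (body-⊆ A∈) □a , ¬a ∘ ≈-from cl W≈U (body-⊆ A∈ ∘ there))
        in ~-elim (hyp (∈-map⁺ _ W∈candidates)) (diagram-intro cl W≈U)

    final : ∀ U → (∀ {C} → C ∈ (map □_ Γ ⇛ □ (□ A ⇒ A)) ∷ (□ (□ A ⇒ A) ⇒ □ A) ∷ map (λ B → □ B ⇒ □ □ B) boxed →
      eval U ⊩ C) → eval U ⊩ ~ (diagram V)
    final U hyp = ~-intro λ diag →
      let cl = eval-classical U
          V≈U = diagram-elim cl diag
          □boxed : ∀ {B} → B ∈ boxed → eval U ⊩ □ B
          □boxed B∈ = let B∈bodies , □B = ∈-filter⁻ (λ B → eval V ⊩? □ B) B∈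
                      in ≈-from cl V≈U (body-⊆ B∈bodies) □B
          □Γ : ∀ {B} → B ∈ Γ → eval U ⊩ □ B
          □Γ B∈ = [ □boxed , ∈-map-elim (λ C → eval U ⊩ □ C) (λ i →
                 ⇒-elim (hyp (there (there (∈-map⁺ _ i)))) (□boxed i)) ]′ (∈-++⁻ boxed B∈)
          □Löb = ⇛-elim U (map □_ Γ) (hyp (here refl)) (∈-map-elim (eval U ⊩_) □Γ)
      in ¬A (inj₁ (≈-to cl V≈U (body-⊆ A∈) (⇒-elim (hyp (there (here refl))) □Löb)))
      where
      open Eval U

  -- The counter strictly decreases along successors. This gives converse well-foundedness, although
  -- `≼` may be reflexive at some types.
  Node : Set
  Node = (Fm → Bool) × ℕ

  above? : ∀ ((V , k) (W , j) : Node) → Dec (eval V ≼ eval W × Real j W)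
  above? (V , k) (W , j) = (eval V ≼? eval W) ×-dec real? j W

  nodes-above : Node → List Node
  nodes-above (V , k) = filter (above? (V , k)) (cartesianProduct types (upTo k))

  ∈-nodes-above⁺ : ∀ {V k W j} → W ∈ types → j < k → eval V ≼ eval W → Real j W → (W , j) ∈ nodes-above (V , k)
  ∈-nodes-above⁺ {V} {k} W∈ j<k V≼W real =
    ∈-filter⁺ (above? (V , k)) (∈-cartesianProduct⁺ W∈ (∈-upTo⁺ j<k)) (V≼W , real)

  ∈-nodes-above⁻ : ∀ {V k W j} → (W , j) ∈ nodes-above (V , k) → W ∈ types × j < k × eval V ≼ eval W × Real j W
  ∈-nodes-above⁻ {V} {k} i =
    let W,j∈ , V≼W , real = ∈-filter⁻ (above? (V , k)) i
        W∈ , j∈ = ∈-cartesianProduct⁻ types (upTo k) W,j∈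
    in W∈ , ∈-upTo⁻ j∈ , V≼W , real

  canonical : Model
  canonical = record
    { World = Node
    ; succs = nodes-above
    ; succs-trans = λ i j →
        let _ , l<k , V≼W , _ = ∈-nodes-above⁻ i
            U∈ , m<l , W≼U , real = ∈-nodes-above⁻ j
        in ∈-nodes-above⁺ U∈ (<-trans m<l l<k) (≼-trans V≼W W≼U) real
    ; succs-wf = Subrelation.wellFounded (λ i → proj₁ (proj₂ (∈-nodes-above⁻ i)))
                   (On.wellFounded proj₂ <-wellFounded)
    ; val = λ (V , _) p → V (var p) }

  open Model canonical using (□-intro; □-elim)

  -- If a box is false in `V`, realisability supplies a refuting type one level down, which is a
  -- successor; if it is true, `≼` carries its body to every successor.
  truth : ∀ k V A → Real k V → atoms A ⊆ atoms φ → force canonical (V , k) A ≡ eval V A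
  truth k V (var p) real sub = refl
  truth k V ⊥'      real sub = refl
  truth k V (A ⇒ B) real sub
    rewrite truth k V A real (sub ∘ ∈-++⁺ˡ) | truth k V B real (sub ∘ ∈-++⁺ʳ (atoms A)) = refl
  truth (suc k) V (□ A) real sub = ⊩-≡ {force canonical (V , suc k)} {□ A} {eval V} {□ A} to from
    where
    to : force canonical (V , suc k) ⊩ □ A → eval V ⊩ □ A
    to h with All.lookup real (body sub)
    ... | inj₁ □a = □a
    ... | inj₂ w with W , W∈ , (V≼W , _ , ¬a) , realW ← find w =
      contradiction (holds (trans (sym (truth k W A realW (sub ∘ there)))
                      (isTrue (□-elim h (∈-nodes-above⁺ W∈ ≤-refl V≼W realW))))) ¬a
    from : eval V ⊩ □ A → force canonical (V , suc k) ⊩ □ A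
    from □a = □-intro λ { {W , j} i → let _ , _ , V≼W , realW = ∈-nodes-above⁻ i in
      holds (trans (truth j W A realW (sub ∘ there)) (isTrue (proj₂ (All.lookup V≼W (body sub) □a)))) }

  completeness : (∀ M x → force M x ⊩ φ) → GL⊢ φ
  completeness valid = tautological-consequence (map (λ V → ~ (diagram V)) (filter countermodel? types))
    (∈-map-elim GL⊢_ refutable)
    λ U hyp → decidable-stable (eval U ⊩? φ) λ ¬φ →
      let W , W∈ , W≈U = type-of (eval U)
          cl = eval-classical U
          W∈′ = ∈-filter⁺ countermodel? W∈ (¬φ ∘ ≈-from cl W≈U id)
      in Eval.~-elim U (hyp (∈-map⁺ _ W∈′)) (diagram-intro cl W≈U)
    where
    countermodel? : ∀ V → Dec (¬ eval V ⊩ φ)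
    countermodel? V = ¬? (eval V ⊩? φ)
    refutable : ∀ {V} → V ∈ filter countermodel? types → GL⊢ (~ (diagram V))
    -- `suc (length bodies)` exceeds every height. Were `V` realisable at this level, its node would
    -- be a countermodel to `φ`.
    refutable {V} V∈ = unreal-refutable (suc (length bodies)) V (s≤s height-≤) λ real →
      proj₂ (∈-filter⁻ countermodel? {xs = types} V∈)
        (holds (trans (sym (truth _ V φ real id)) (isTrue (valid canonical (V , _)))))

open Completeness using (completeness)

-- The interpolant

var⁺∈atoms : ∀ A {p} → p ∈ v⁺ A → var p ∈ atoms A
var⁻∈atoms : ∀ A {p} → p ∈ v⁻ A → var p ∈ atoms A
var⁺∈atoms (var p) (here refl) = here refl
var⁺∈atoms (A ⇒ B) i = [ ∈-++⁺ˡ ∘ var⁻∈atoms A , ∈-++⁺ʳ (atoms A) ∘ var⁺∈atoms B ]′ (∈-++⁻ (v⁻ A) i)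
var⁺∈atoms (□ A)   i = there (var⁺∈atoms A i)
var⁻∈atoms (A ⇒ B) i = [ ∈-++⁺ˡ ∘ var⁺∈atoms A , ∈-++⁺ʳ (atoms A) ∘ var⁻∈atoms B ]′ (∈-++⁻ (v⁺ A) i)
var⁻∈atoms (□ A)   i = there (var⁻∈atoms A i)

-- Both polarity conditions and the depth bound travel together, with `R` and `S` exchanged to the
-- left of an implication, so that one recursion establishes all three.
record Fragment (R S : ℕ → Set) (d : ℕ) (A : Fm) : Set where
  constructor fragment
  field
    pos     : ∀ x → x ∈ v⁺ A → R x
    neg     : ∀ x → x ∈ v⁻ A → S x
    depth-≤ : depth A ≤ d

module _ {R S : ℕ → Set} {d : ℕ} where

  weaken : ∀ {e} → d ≤ e → Fragment R S d A → Fragment R S e A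
  weaken d≤e (fragment a⁺ a⁻ a) = fragment a⁺ a⁻ (≤-trans a d≤e)

  fragment-var : ∀ {p} → R p → Fragment R S d (var p)
  fragment-var r = fragment (λ { x (here refl) → r }) (λ x ()) z≤n

  fragment-⊥ : Fragment R S d ⊥'
  fragment-⊥ = fragment (λ x ()) (λ x ()) z≤n

  fragment-⇒ : Fragment S R d A → Fragment R S d B → Fragment R S d (A ⇒ B)
  fragment-⇒ {A} (fragment a⁺ a⁻ a) (fragment b⁺ b⁻ b) = fragment
    (λ x i → [ a⁻ x , b⁺ x ]′ (∈-++⁻ (v⁻ A) i)) (λ x i → [ a⁺ x , b⁻ x ]′ (∈-++⁻ (v⁺ A) i)) (⊔-lub a b)

  fragment-□ : Fragment R S d A → Fragment R S (suc d) (□ A)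
  fragment-□ (fragment a⁺ a⁻ a) = fragment a⁺ a⁻ (s≤s a)

fragment-~ : ∀ {R S d} → Fragment S R d A → Fragment R S d (~ A)
fragment-~ a = fragment-⇒ a fragment-⊥

module _ {R S : ℕ → Set} {d : ℕ} where

  fragment-∧ : Fragment R S d A → Fragment R S d B → Fragment R S d (A ∧′ B)
  fragment-∧ a b = fragment-~ (fragment-⇒ a (fragment-~ b))

  fragment-∨ : Fragment R S d A → Fragment R S d B → Fragment R S d (A ∨′ B)
  fragment-∨ a b = fragment-⇒ (fragment-~ a) b

  fragment-◇ : Fragment R S d A → Fragment R S (suc d) (◇ A)
  fragment-◇ a = fragment-~ (fragment-□ (fragment-~ a))

  fragment-⋀ : ∀ {G : I → Fm} xs → (∀ {i} → i ∈ xs → Fragment R S d (G i)) → Fragment R S d (⋀ G xs)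
  fragment-⋀ []       h = fragment-~ fragment-⊥
  fragment-⋀ (x ∷ xs) h = fragment-∧ (h (here refl)) (fragment-⋀ xs (h ∘ there))

  fragment-⋁ : ∀ {G : I → Fm} xs → (∀ {i} → i ∈ xs → Fragment R S d (G i)) → Fragment R S d (⋁ G xs)
  fragment-⋁ []       h = fragment-⊥
  fragment-⋁ (x ∷ xs) h = fragment-∨ (h (here refl)) (fragment-⋁ xs (h ∘ there))

module Interpolant (φ : Fm) (P Q : List ℕ) where
  open Closure φ
  open DecMembership ℕ._≟_ using (_∈?_)

  _⊑_ : (Fm → Bool) → (Fm → Bool) → Set
  f ⊑ g = All (λ B → f ⊩ □ B → g ⊩ □ B) bodies

  positive? : ∀ V p → Dec (p ∉ P × eval V ⊩ var p)
  positive? V p = ¬? (p ∈? P) ×-dec (eval V ⊩? var p)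

  negative? : ∀ V p → Dec (p ∉ Q × ¬ eval V ⊩ var p)
  negative? V p = ¬? (p ∈? Q) ×-dec ¬? (eval V ⊩? var p)

  refuting? : ∀ V A W → Dec (eval V ≼ eval W × ¬ eval W ⊩ A)
  refuting? V A W = (eval V ≼? eval W) ×-dec ¬? (eval W ⊩? A)

  unboxed? : ∀ f A → Dec (¬ f ⊩ □ A)
  unboxed? f A = ¬? (f ⊩? □ A)

  -- Since `≼` preserves boxes, such a `W` has exactly the boxes of `V`, and therefore the same
  -- types lie above `W` as above `V`.
  cluster? : ∀ V W → Dec (eval V ≼ eval W × eval W ⊑ eval V)
  cluster? V W = (eval V ≼? eval W) ×-dec all? (λ B → (eval W ⊩? □ B) →-dec (eval V ⊩? □ B)) bodies

  above? : ∀ V W → Dec (eval V ≼ eval W)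
  above? V W = eval V ≼? eval W

  -- The part of `V` on the variables that an interpolant may state: truths at permitted positive
  -- variables and falsehoods at permitted negative ones.
  literals : (Fm → Bool) → Fm
  literals V = ⋀ var (filter (positive? V) (v⁺ φ)) ∧′ ⋀ (λ p → ~ var p) (filter (negative? V) (v⁻ φ))

  demands : ((Fm → Bool) → Fm) → (Fm → Bool) → Fm
  demands X V = ⋀ (λ A → ◇ (⋁ X (filter (refuting? V A) types))) (filter (unboxed? (eval V)) bodies)

  local : ((Fm → Bool) → Fm) → (Fm → Bool) → Fm
  local X V = literals V ∧′ demands X V

  global : ((Fm → Bool) → Fm) → (Fm → Bool) → Fm
  global X V = □ (⋁ (local X) (filter (cluster? V) types) ∨′ ⋁ X (filter (above? V) types))

  -- The first disjunction of global uses local, not simulates (suc k): since x sees everything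
  -- its successors see, global is inherited by the successors in the same cluster.
  simulates : ℕ → (Fm → Bool) → Fm
  simulates zero    V = ⊥'
  simulates (suc k) V = local (simulates k) V ∧′ global (simulates k) V

  satisfying? : ∀ V → Dec (eval V ⊩ φ)
  satisfying? V = eval V ⊩? φ

  interpolant : Fm
  interpolant = ⋁ (simulates (suc (length bodies))) (filter satisfying? types)

  Lyndon : ℕ → Fm → Set
  Lyndon = Fragment (λ p → p ∈ v⁺ φ × p ∉ P) (λ p → p ∈ v⁻ φ × p ∉ Q)

  local-Lyndon : ∀ {X d} → (∀ V → Lyndon d (X V)) → ∀ V → Lyndon (suc d) (local X V)
  local-Lyndon hX V = fragment-∧
    (fragment-∧
      (fragment-⋀ (filter (positive? V) (v⁺ φ)) λ i →
        let p∈ , p∉P , _ = ∈-filter⁻ (positive? V) i in fragment-var (p∈ , p∉P))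
      (fragment-⋀ (filter (negative? V) (v⁻ φ)) λ i →
        let p∈ , p∉Q , _ = ∈-filter⁻ (negative? V) i in fragment-~ (fragment-var (p∈ , p∉Q))))
    (fragment-⋀ (filter (unboxed? (eval V)) bodies) λ {A} _ →
      fragment-◇ (fragment-⋁ (filter (refuting? V A) types) λ {W} _ → hX W))

  -- The box of `global` encloses the diamonds of `local`, so each level adds two to the depth.
  simulates-Lyndon : ∀ k V → Lyndon (k * 2) (simulates k V)
  simulates-Lyndon zero    V = fragment-⊥
  simulates-Lyndon (suc k) V = fragment-∧
    (weaken (n≤1+n _) (local-Lyndon (simulates-Lyndon k) V))
    (fragment-□ (fragment-∨
      (fragment-⋁ (filter (cluster? V) types) λ {W} _ → local-Lyndon (simulates-Lyndon k) W)
      (fragment-⋁ (filter (above? V) types) λ {W} _ → weaken (n≤1+n _) (simulates-Lyndon k W))))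

  interpolant-Lyndon : Lyndon (suc (length bodies) * 2) interpolant
  interpolant-Lyndon = fragment-⋁ (filter satisfying? types) λ {V} _ → simulates-Lyndon _ V

  -- The formula implies its interpolant.

  module _ (M : Model) where
    open Model M hiding (force)
    open Force

    -- Separated from `simulates-type` because it is applied at a world and again at its successors
    -- with the same boxes, where the height has not dropped and the induction hypothesis alone
    -- would not suffice.
    local-type : ∀ k → (∀ y W → W ≈ force M y → height (force M y) < k → force M y ⊩ simulates k W) →
      ∀ x V → V ≈ force M x → height (force M x) < suc k → force M x ⊩ local (simulates k) V
    local-type k ih x V V≈x (s≤s hx≤k) = ∧-intro
      (∧-intro
        (⋀-intro (filter (positive? V) (v⁺ φ)) λ i →
          let p∈ , _ , Vp = ∈-filter⁻ (positive? V) i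
          in ≈-from cl V≈x (λ { (here refl) → var⁺∈atoms φ p∈ }) Vp)
        (⋀-intro (filter (negative? V) (v⁻ φ)) λ i →
          let p∈ , _ , ¬Vp = ∈-filter⁻ (negative? V) i
          in ~-intro (¬Vp ∘ ≈-to cl V≈x λ { (here refl) → var⁻∈atoms φ p∈ })))
      (⋀-intro (filter (unboxed? (eval V)) bodies) λ {A} i →
        let A∈ , ¬□a = ∈-filter⁻ (unboxed? (eval V)) {xs = bodies} i
            ¬□a′ = ¬□a ∘ ≈-to cl V≈x (body-⊆ A∈)
            -- A last refuting successor gains the box `□ A`, so its height drops and `ih` applies.
            y , y∈ , ¬a , □a = ¬□-last ¬□a′
            W , W∈ , W≈y = type-of (force M y)
            x≼y = force-≼ M y∈
            V≼W = ≈-≼ cl (force-classical y) V≈x W≈y x≼y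
            ¬Wa = ¬a ∘ ≈-from (force-classical y) W≈y (body-⊆ A∈ ∘ there)
        in ◇-intro y∈ (⋁-intro (∈-filter⁺ (refuting? V A) W∈ (V≼W , ¬Wa))
             (ih y W W≈y (<-≤-trans (height-< x≼y A∈ ¬□a′ □a) hx≤k))))
      where cl = force-classical x

    -- A successor with no new true box lies in the cluster and needs only its local part; any other
    -- successor has smaller height and falls under the induction hypothesis.
    simulates-type : ∀ k x V → V ≈ force M x → height (force M x) < k → force M x ⊩ simulates k V
    simulates-type (suc k) x V V≈x hx = ∧-intro (local-type k (simulates-type k) x V V≈x hx) (□-intro successor)
      where
      cl = force-classical x
      successor : ∀ {y} → y ∈ succs x → force M y ⊩
        (⋁ (local (simulates k)) (filter (cluster? V) types) ∨′ ⋁ (simulates k) (filter (above? V) types))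
      successor {y} y∈ with type-of (force M y) | all? (λ B → (force M y ⊩? □ B) →-dec (force M x ⊩? □ B)) bodies
      ... | W , W∈ , W≈y | yes y⊑x = ∨-introˡ (⋁-intro (∈-filter⁺ (cluster? V) W∈ (V≼W , W⊑V))
                                        (local-type k (simulates-type k) y W W≈y (≤-trans (s≤s hy≤hx) hx)))
        where
        V≼W = ≈-≼ cl (force-classical y) V≈x W≈y (force-≼ M y∈)
        W⊑V = All.tabulate λ B∈ □b → ≈-to cl V≈x (body-⊆ B∈)
                (All.lookup y⊑x B∈ (≈-from (force-classical y) W≈y (body-⊆ B∈) □b))
        hy≤hx : height (force M y) ≤ height (force M x)
        hy≤hx = length-filter-≤ (unboxed? (force M y)) (unboxed? (force M x)) bodies
                  λ _ ¬y x□ → ¬y (□-trans x□ y∈)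
      ... | W , W∈ , W≈y | no y⋢x with find (¬All⇒Any¬ (λ B → (force M y ⊩? □ B) →-dec (force M x ⊩? □ B)) bodies y⋢x)
      ...   | A , A∈ , ¬imp = ∨-introʳ (⋁-intro (∈-filter⁺ (above? V) W∈ V≼W) (simulates-type k y W W≈y hy<k))
        where
        V≼W = ≈-≼ cl (force-classical y) V≈x W≈y (force-≼ M y∈)
        hy<k = <-≤-trans (height-< (force-≼ M y∈) A∈ (λ x□ → ¬imp λ _ → x□)
                 (decidable-stable (force M y ⊩? □ A) λ ¬y□ → ¬imp λ y□ → contradiction y□ ¬y□)) (s≤s⁻¹ hx)

    interpolant-implied : ∀ x → force M x ⊩ φ → force M x ⊩ interpolant
    interpolant-implied x h =
      let V , V∈ , V≈x = type-of (force M x)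
      in ⋁-intro (∈-filter⁺ satisfying? V∈ (≈-to (force-classical x) V≈x id h))
           (simulates-type _ x V V≈x (s≤s height-≤))

  -- The amalgam of a model with the types simulated in it.

  module Amalgam (M : Model) where
    private module M = Model M
    open M.Force

    Node : Set
    Node = M.World × (Fm → Bool) × ℕ

    successor? : ∀ ((x , V , k) (y , W , j) : Node) → Dec (eval V ≼ eval W × force M y ⊩ simulates j W)
    successor? (x , V , k) (y , W , j) = (eval V ≼? eval W) ×-dec (force M y ⊩? simulates j W)

    -- The counter may stay constant here, as it must within a cluster: converse well-foundedness is
    -- inherited from `M` through the first component.
    successors : Node → List Node
    successors (x , V , k) =
      filter (successor? (x , V , k)) (cartesianProduct (M.succs x) (cartesianProduct types (upTo (suc k))))

    record Successor (x : M.World) (V : Fm → Bool) (k : ℕ) (y : M.World) (W : Fm → Bool) (j : ℕ) : Set where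
      constructor successor
      field
        y∈  : y ∈ M.succs x
        W∈  : W ∈ types
        j≤k : j ≤ k
        V≼W : eval V ≼ eval W
        sim : force M y ⊩ simulates j W

    ∈-successors⁺ : ∀ {x V k y W j} → Successor x V k y W j → (y , W , j) ∈ successors (x , V , k)
    ∈-successors⁺ {x} {V} {k} (successor y∈ W∈ j≤k V≼W sim) = ∈-filter⁺ (successor? (x , V , k))
      (∈-cartesianProduct⁺ y∈ (∈-cartesianProduct⁺ W∈ (∈-upTo⁺ (s≤s j≤k)))) (V≼W , sim)

    ∈-successors⁻ : ∀ {x V k y W j} → (y , W , j) ∈ successors (x , V , k) → Successor x V k y W j
    ∈-successors⁻ {x} {V} {k} i =
      let i′ , V≼W , sim = ∈-filter⁻ (successor? (x , V , k)) i
          y∈ , i″ = ∈-cartesianProduct⁻ (M.succs x) (cartesianProduct types (upTo (suc k))) i′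
          W∈ , j∈ = ∈-cartesianProduct⁻ types (upTo (suc k)) i″
      in successor y∈ W∈ (s≤s⁻¹ (∈-upTo⁻ j∈)) V≼W sim

    -- The value of p at x is kept, unless φ needs that of V.
    Holds : Node → ℕ → Set
    Holds (x , V , k) p =
      (p ∈ v⁺ φ × eval V ⊩ var p) ⊎ (force M x ⊩ var p × (p ∈ v⁻ φ → eval V ⊩ var p))

    holds? : ∀ n p → Dec (Holds n p)
    holds? (x , V , k) p =
      ((p ∈? v⁺ φ) ×-dec (eval V ⊩? var p)) ⊎-dec
      ((force M x ⊩? var p) ×-dec ((p ∈? v⁻ φ) →-dec (eval V ⊩? var p)))

    amalgam : Model
    amalgam = record
      { World = Node
      ; succs = successors
      ; succs-trans = λ i j →
          let successor y∈ _ l≤k V≼W _ = ∈-successors⁻ i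
              successor z∈ U∈ m≤l W≼U sim = ∈-successors⁻ j
          in ∈-successors⁺ (successor (M.succs-trans y∈ z∈) U∈ (≤-trans m≤l l≤k) (≼-trans V≼W W≼U) sim)
      ; succs-wf = Subrelation.wellFounded (Successor.y∈ ∘ ∈-successors⁻) (On.wellFounded proj₁ M.succs-wf)
      ; val = λ n p → does (holds? n p) }

    module K = Model amalgam

    val-intro : ∀ {n p} → Holds n p → K.force n ⊩ var p
    val-intro {n} {p} h = holds (dec-true (holds? n p) h)

    val-elim : ∀ {n p} → K.force n ⊩ var p → Holds n p
    val-elim {n} {p} (holds h) = decidable-stable (holds? n p) λ ¬q →
      contradiction (trans (sym h) (dec-false (holds? n p) ¬q)) λ ()

    simulates-local : ∀ {k x V} → force M x ⊩ simulates (suc k) V → force M x ⊩ local (simulates k) V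
    simulates-local h = proj₁ (∧-elim h)

    literal⁺ : ∀ {k x V p} → force M x ⊩ simulates k V → p ∈ v⁺ φ → p ∉ P → eval V ⊩ var p → force M x ⊩ var p
    literal⁺ {zero}  s = contradiction s ⊥-absurd
    literal⁺ {suc k} {V = V} s p∈ p∉P Vp =
      ⋀-elim (proj₁ (∧-elim (proj₁ (∧-elim (simulates-local {k} {V = V} s))))) (∈-filter⁺ (positive? V) p∈ (p∉P , Vp))

    literal⁻ : ∀ {k x V p} → force M x ⊩ simulates k V → p ∈ v⁻ φ → p ∉ Q → force M x ⊩ var p → eval V ⊩ var p
    literal⁻ {zero}  s = contradiction s ⊥-absurd
    literal⁻ {suc k} {V = V} {p} s p∈ p∉Q xp = decidable-stable (eval V ⊩? var p) λ ¬Vp → ~-elim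
      (⋀-elim (proj₂ (∧-elim (proj₁ (∧-elim (simulates-local {k} {V = V} s))))) (∈-filter⁺ (negative? V) p∈ (p∉Q , ¬Vp))) xp

    demand : ∀ {k x V A} → force M x ⊩ simulates k V → A ∈ bodies → ¬ eval V ⊩ □ A →
      ∃[ y ] ∃[ W ] ∃[ j ] Successor x V k y W j × ¬ eval W ⊩ A
    demand {zero}  s = contradiction s ⊥-absurd
    demand {suc k} {V = V} {A} s A∈ ¬□a =
      let y , y∈ , h = M.◇-elim (⋀-elim (proj₂ (∧-elim (simulates-local {k} {V = V} s)))
                                  (∈-filter⁺ (unboxed? (eval V)) A∈ ¬□a))
          W , W∈′ , sim = ⋁-elim (filter (refuting? V A) types) h
          W∈ , V≼W , ¬a = ∈-filter⁻ (refuting? V A) W∈′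
      in y , W , k , successor y∈ W∈ (n≤1+n k) V≼W sim , ¬a

    -- global (simulates k) V only depends on the boxes of V.
    follow : ∀ {k x V y} → force M x ⊩ simulates k V → y ∈ M.succs x → ∃[ W ] ∃[ j ] Successor x V k y W j
    follow {zero}  s = contradiction s ⊥-absurd
    follow {suc k} {V = V} {y} s y∈ with ∨-elim (M.□-elim (proj₂ (∧-elim s)) y∈)
    ... | inj₂ h =
      let W , W∈′ , sim = ⋁-elim (filter (above? V) types) h
          W∈ , V≼W = ∈-filter⁻ (above? V) W∈′
      in W , k , successor y∈ W∈ (n≤1+n k) V≼W sim
    ... | inj₁ h with ⋁-elim (filter (cluster? V) types) h
    ...   | W , W∈′ , loc with ∈-filter⁻ (cluster? V) {xs = types} W∈′
    ...     | W∈ , V≼W , W⊑V =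
      W , suc k , successor y∈ W∈ ≤-refl V≼W (∧-intro loc (M.□-intro inherit))
      where
      inherit : ∀ {z} → z ∈ M.succs y → force M z ⊩
        (⋁ (local (simulates k)) (filter (cluster? W) types) ∨′ ⋁ (simulates k) (filter (above? W) types))
      -- By transitivity the box at `x` already speaks about `z`; as `W` and `V` have the same
      -- boxes, the type it offers above `V` is also above `W`.
      inherit z∈ with ∨-elim (M.□-elim (proj₂ (∧-elim s)) (M.succs-trans y∈ z∈))
      ... | inj₁ h =
        let U , U∈′ , loc = ⋁-elim (filter (cluster? V) types) h
            U∈ , V≼U , U⊑V = ∈-filter⁻ (cluster? V) {xs = types} U∈′
        in ∨-introˡ (⋁-intro (∈-filter⁺ (cluster? W) U∈
             (W≼ V≼U , All.tabulate λ B∈ → proj₁ ∘ All.lookup V≼W B∈ ∘ All.lookup U⊑V B∈)) loc)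
        where
        W≼ : ∀ {U} → eval V ≼ eval U → eval W ≼ eval U
        W≼ V≼U = All.tabulate λ B∈ → All.lookup V≼U B∈ ∘ All.lookup W⊑V B∈
      ... | inj₂ h =
        let U , U∈′ , sim = ⋁-elim (filter (above? V) types) h
            U∈ , V≼U = ∈-filter⁻ (above? V) {xs = types} U∈′
        in ∨-introʳ (⋁-intro (∈-filter⁺ (above? W) U∈
             (All.tabulate λ B∈ → All.lookup V≼U B∈ ∘ All.lookup W⊑V B∈)) sim)

    mutual
      -- Proved together with its converse `K⇒type`, which has the polarities exchanged. The
      -- valuation makes true what `V` makes true on `v⁺ φ`, and on `v⁻ φ` nothing beyond `V`. For
      -- boxes, `≼` serves this direction and `demand` the converse.
      type⇒K : ∀ A {k x V} → force M x ⊩ simulates k V → atoms A ⊆ atoms φ → v⁺ A ⊆ v⁺ φ → v⁻ A ⊆ v⁻ φ →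
        eval V ⊩ A → K.force (x , V , k) ⊩ A
      type⇒K (var p) s sub a⁺ a⁻ h = val-intro (inj₁ (a⁺ (here refl) , h))
      type⇒K ⊥' {V = V} s sub a⁺ a⁻ h = contradiction h (Eval.⊥-absurd V)
      type⇒K (A ⇒ B) {V = V} s sub a⁺ a⁻ h = K.Force.⇒-intro λ a →
        type⇒K B s (sub ∘ ∈-++⁺ʳ (atoms A)) (a⁺ ∘ ∈-++⁺ʳ (v⁻ A)) (a⁻ ∘ ∈-++⁺ʳ (v⁺ A))
          (Eval.⇒-elim V h (K⇒type A s (sub ∘ ∈-++⁺ˡ) (a⁻ ∘ ∈-++⁺ˡ) (a⁺ ∘ ∈-++⁺ˡ) a))
      type⇒K (□ A) s sub a⁺ a⁻ h = K.□-intro λ i →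
        let successor _ _ _ V≼W sim = ∈-successors⁻ i
        in type⇒K A sim (sub ∘ there) a⁺ a⁻ (proj₂ (All.lookup V≼W (body sub) h))

      K⇒type : ∀ A {k x V} → force M x ⊩ simulates k V → atoms A ⊆ atoms φ → v⁺ A ⊆ v⁻ φ → v⁻ A ⊆ v⁺ φ →
        K.force (x , V , k) ⊩ A → eval V ⊩ A
      K⇒type (var p) s sub a⁺ a⁻ h with val-elim h
      ... | inj₁ (_ , Vp) = Vp
      ... | inj₂ (_ , Vp) = Vp (a⁺ (here refl))
      K⇒type ⊥' s sub a⁺ a⁻ h = contradiction h K.Force.⊥-absurd
      K⇒type (A ⇒ B) {V = V} s sub a⁺ a⁻ h = Eval.⇒-intro V λ a →
        K⇒type B s (sub ∘ ∈-++⁺ʳ (atoms A)) (a⁺ ∘ ∈-++⁺ʳ (v⁻ A)) (a⁻ ∘ ∈-++⁺ʳ (v⁺ A))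
          (K.Force.⇒-elim h (type⇒K A s (sub ∘ ∈-++⁺ˡ) (a⁻ ∘ ∈-++⁺ˡ) (a⁺ ∘ ∈-++⁺ˡ) a))
      K⇒type (□ A) {V = V} s sub a⁺ a⁻ h = decidable-stable (eval V ⊩? □ A) λ ¬□a →
        let y , W , j , next , ¬a = demand s (body sub) ¬□a
        in ¬a (K⇒type A (Successor.sim next) (sub ∘ there) a⁺ a⁻ (K.□-elim h (∈-successors⁺ next)))

    mutual
      -- The projection to `M` acts as a directed bisimulation. A variable made true for the sake of
      -- `V` is true at `x` by `literal⁺` when it is outside `P`; one true at `x` is kept by
      -- `literal⁻` when it is outside `Q`. `follow` lifts successors of `x` to the amalgam, and
      -- successors in the amalgam project to `M`.
      K⇒M : ∀ A {k x V} → force M x ⊩ simulates k V → (∀ p → p ∈ v⁺ A → p ∉ P) → (∀ p → p ∈ v⁻ A → p ∉ Q) →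
        K.force (x , V , k) ⊩ A → force M x ⊩ A
      K⇒M (var p) s a⁺ a⁻ h with val-elim h
      ... | inj₁ (p∈ , Vp) = literal⁺ s p∈ (a⁺ p (here refl)) Vp
      ... | inj₂ (xp , _)  = xp
      K⇒M ⊥' s a⁺ a⁻ h = contradiction h K.Force.⊥-absurd
      K⇒M (A ⇒ B) s a⁺ a⁻ h = ⇒-intro λ a →
        K⇒M B s (λ p → a⁺ p ∘ ∈-++⁺ʳ (v⁻ A)) (λ p → a⁻ p ∘ ∈-++⁺ʳ (v⁺ A))
          (K.Force.⇒-elim h (M⇒K A s (λ p → a⁻ p ∘ ∈-++⁺ˡ) (λ p → a⁺ p ∘ ∈-++⁺ˡ) a))
      K⇒M (□ A) s a⁺ a⁻ h = M.□-intro λ y∈ →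
        let W , j , next = follow s y∈
        in K⇒M A (Successor.sim next) a⁺ a⁻ (K.□-elim h (∈-successors⁺ next))

      M⇒K : ∀ A {k x V} → force M x ⊩ simulates k V → (∀ p → p ∈ v⁺ A → p ∉ Q) → (∀ p → p ∈ v⁻ A → p ∉ P) →
        force M x ⊩ A → K.force (x , V , k) ⊩ A
      M⇒K (var p) s a⁺ a⁻ h = val-intro (inj₂ (h , λ p∈ → literal⁻ s p∈ (a⁺ p (here refl)) h))
      M⇒K ⊥' s a⁺ a⁻ h = contradiction h ⊥-absurd
      M⇒K (A ⇒ B) s a⁺ a⁻ h = K.Force.⇒-intro λ a →
        M⇒K B s (λ p → a⁺ p ∘ ∈-++⁺ʳ (v⁻ A)) (λ p → a⁻ p ∘ ∈-++⁺ʳ (v⁺ A))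
          (⇒-elim h (K⇒M A s (λ p → a⁻ p ∘ ∈-++⁺ˡ) (λ p → a⁺ p ∘ ∈-++⁺ˡ) a))
      M⇒K (□ A) s a⁺ a⁻ h = K.□-intro λ i →
        let successor y∈ _ _ _ sim = ∈-successors⁻ i
        in M⇒K A sim a⁺ a⁻ (M.□-elim h y∈)

  -- The disjunct true at `x` gives a type `V` satisfying `φ`. In the amalgam `(x , V)` then forces
  -- `φ`, hence `ψ` by soundness, and `ψ` projects back to `x`.
  interpolant-least : ∀ ψ → (∀ p → p ∈ v⁺ ψ → p ∉ P) → (∀ p → p ∈ v⁻ ψ → p ∉ Q) →
    GL⊢ (φ ⇒ ψ) → ∀ M x → force M x ⊩ interpolant → force M x ⊩ ψ
  interpolant-least ψ ψ⁺ ψ⁻ φ⇒ψ M x h =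
    let V , V∈′ , s = Model.Force.⋁-elim M (filter satisfying? types) h
        _ , Vφ = ∈-filter⁻ satisfying? {xs = types} V∈′
    in K⇒M ψ s ψ⁺ ψ⁻ (K.Force.⇒-elim (soundness φ⇒ψ amalgam (x , V , _)) (type⇒K φ s id id id Vφ))
    where open Amalgam M

  interpolant-IsULI : IsULI GL⊢_ φ P Q interpolant
  interpolant-IsULI =
      pos
    , neg
    , completeness (φ ⇒ interpolant) (λ M x → Model.Force.⇒-intro M (interpolant-implied M x))
    , λ ψ ψ⁺ ψ⁻ φ⇒ψ → completeness (interpolant ⇒ ψ) λ M x →
        Model.Force.⇒-intro M (interpolant-least ψ ψ⁺ ψ⁻ φ⇒ψ M x)
    where open Fragment interpolant-Lyndon

  interpolant-depth : depth interpolant ≤ 3 * nBox φ + 3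
  interpolant-depth = begin
    depth interpolant ≤⟨ Fragment.depth-≤ interpolant-Lyndon ⟩
    -- The construction yields `2n(φ) + 2`, which is relaxed here to the required bound.
    suc (nBox φ) * 2  ≤⟨ *-monoʳ-≤ (suc (nBox φ)) (n≤1+n 2) ⟩
    suc (nBox φ) * 3  ≡⟨ *-comm (suc (nBox φ)) 3 ⟩
    3 * suc (nBox φ)  ≡⟨ *-suc 3 (nBox φ) ⟩
    3 + 3 * nBox φ    ≡⟨ +-comm 3 (3 * nBox φ) ⟩
    3 * nBox φ + 3    ∎
    where open ≤-Reasoning

theorem5p2 : (∀ (φ : Fm) (P Q : List ℕ) → Σ Fm (λ θ → IsULI GL⊢_ φ P Q θ))
    × (∀ (φ : Fm) (P Q : List ℕ) →
    Σ Fm (λ θ → IsULI GL⊢_ φ P Q θ × depth θ ≤ 3 * nBox φ + 3))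
theorem5p2 = (λ φ P Q → let open Interpolant φ P Q in interpolant , interpolant-IsULI)
           , (λ φ P Q → let open Interpolant φ P Q in interpolant , interpolant-IsULI , interpolant-depth)
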